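{- Let $\mathscr{C}$ be a positive variety. Then the covering problem for the class $(\mathscr{C}\circ\mathsf{SU})\circ\mathsf{MOD}$ can be effectively reduced to the covering problem for the class $\mathscr{C}\circ\mathsf{SU}$. Likewise, the separation problem for $(\mathscr{C}\circ\mathsf{SU})\circ\mathsf{MOD}$ can be effectively reduced to the separation problem for $\mathscr{C}\circ\mathsf{SU}$.
   Context: A class of languages $\mathscr{C}$ assigns to every finite alphabet $A$ a set $\mathscr{C}(A)$ of regular languages over $A$. It is a lattice if each $\mathscr{C}(A)$ contains $\emptyset$ and $A^*$ and is closed under finite unions and intersections; it is quotient-closed if for all $L\in\mathscr{C}(A)$ and $u\in A^*$, the languages $u^{ -1}L=\{v\mid uv\in L\}$ and $Lu^{ -1}=\{v\mid vu\in L\}$ are in $\mathscr{C}(A)$. A positive variety is a quotient-closed lattice closed under inverse images of all monoid morphisms $\alpha:A^*\to B^*$ (i.e. $L\in\mathscr{C}(B)\Rightarrow \alpha^{ -1}(L)\in\mathscr{C}(A)$). Enrichment: for a finite partition $\mathbf{P}$ of $A^*$ and $u\in A^*$, let $[u]_{\mathbf{P}}$ be the block of $\mathbf{P}$ containing $u$. The $\mathbf{P}$-tagging $\tau_{\mathbf{P}}:A^*\to(\mathbf{P}\times A)^*$ is defined by $\tau_{\mathbf{P}}(\varepsilon)=\varepsilon$ and $\tau_{\mathbf{P}}(a_1\cdots a_n)=b_1\cdots b_n$ with $b_i=([a_1\cdots a_{i-1}]_{\mathbf{P}},a_i)$ (so $b_1=([\varepsilon]_{\mathbf{P}},a_1)$).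 A language $L\subseteq A^*$ is $\mathbf{P}$-liftable from $\mathscr{C}$ if there are $L_P\in\mathscr{C}(\mathbf{P}\times A)$ for $P\in\mathbf{P}$ with $L=\bigcup_{P\in\mathbf{P}}(\tau_{\mathbf{P}}^{ -1}(L_P)\cap P)$. For classes $\mathscr{C},\mathscr{D}$, a $\mathscr{D}$-partition of $A^*$ is a finite partition of $A^*$ into languages of $\mathscr{D}(A)$, and $(\mathscr{C}\circ\mathscr{D})(A)$ is the set of languages $L\subseteq A^*$ that are $\mathbf{P}$-liftable from $\mathscr{C}$ for some $\mathscr{D}$-partition $\mathbf{P}$ of $A^*$. $\mathsf{MOD}(A)$ is the set of finite Boolean combinations of languages $\{w\in A^*\mid |w|\equiv m \bmod d\}$ ($m,d\in\mathbb{N}$, $m<d$). $\mathsf{SU}(A)$ is the set of finite Boolean combinations of languages $A^*w$ with $w\in A^*$. Covering and separation: for a class $\mathscr{C}$, a language $L_1\subseteq A^*$ and a finite multiset $\mathbf{L}_2$ of languages over $A$, the pair $(L_1,\mathbf{L}_2)$ is $\mathscr{C}$-coverable if there is a finite set $\mathbf{K}\subseteq\mathscr{C}(A)$ with $L_1\subseteq\bigcup_{K\in\mathbf{K}}K$ such that every $K\in\mathbf{K}$ is disjoint from some $L\in\mathbf{L}_2$. The $\mathscr{C}$-covering problem takes as input a regular $L_1$ and a finite multiset of regular languages $\mathbf{L}_2$ and asks whether $(L_1,\mathbf{L}_2)$ is $\mathscr{C}$-coverable. $L_1$ is $\mathscr{C}$-separable from $L_2$ if some $K\in\mathscr{C}(A)$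 satisfies $L_1\subseteq K$ and $K\cap L_2=\emptyset$; the $\mathscr{C}$-separation problem takes two regular languages and asks this. -}

module Defs where

open import Data.Nat using (ℕ; _+_; _*_)
open import Data.Fin using (Fin; toℕ; combine)
import Data.List
open import Data.List using (List; []; _∷_; _++_; [_]; length; foldl; concatMap)
open import Data.List.Relation.Unary.All using (All)
open import Data.List.Relation.Unary.Any using (Any)
open import Data.Bool using (Bool; T)
open import Data.Product using (Σ; ∃; ∃-syntax; _×_; _,_)
open import Data.Sum using (_⊎_)
open import Data.Empty using (⊥)
open import Level using (Lift)
open import Data.Unit using (⊤)
open import Relation.Nullary using (¬_; Dec)
open import Relation.Binary.PropositionalEquality using (_≡_)

Word : ℕ → Set
Word k = List (Fin k)

Lang : ℕ → Set₁
Lang k = Word k → Set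

_≐_ : ∀ {k} → Lang k → Lang k → Set
L ≐ L′ = ∀ w → (L w → L′ w) × (L′ w → L w)

∅ₗ : ∀ {k} → Lang k
∅ₗ _ = ⊥

Fullₗ : ∀ {k} → Lang k
Fullₗ _ = ⊤

_∪ₗ_ : ∀ {k} → Lang k → Lang k → Lang k
(L ∪ₗ L′) w = L w ⊎ L′ w

_∩ₗ_ : ∀ {k} → Lang k → Lang k → Lang k
(L ∩ₗ L′) w = L w × L′ w

Disjoint : ∀ {k} → Lang k → Lang k → Set
Disjoint L L′ = ∀ w → L w → L′ w → ⊥

leftQuot : ∀ {k} → Word k → Lang k → Lang k
leftQuot u L v = L (u ++ v)

rightQuot : ∀ {k} → Word k → Lang k → Lang k
rightQuot u L v = L (v ++ u)

-- a monoid morphism α : A* → B* is determined by the images of letters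
Morphism : ℕ → ℕ → Set
Morphism k k′ = Fin k → Word k′

applyMor : ∀ {k k′} → Morphism k k′ → Word k → Word k′
applyMor α = concatMap α

preimage : ∀ {k k′} → Morphism k k′ → Lang k′ → Lang k
preimage α L w = L (applyMor α w)

record DFA (k : ℕ) : Set where
  field
    states : ℕ
    init   : Fin states
    δ      : Fin states → Fin k → Fin states
    accept : Fin states → Bool

open DFA public

run : ∀ {k} (D : DFA k) → Fin (states D) → Word k → Fin (states D)
run D q w = foldl (δ D) q w

lang : ∀ {k} → DFA k → Lang k
lang D w = T (accept D (run D (init D) w))

Regular : ∀ {k} → Lang k → Set
Regular {k} L = Σ (DFA k) λ D → L ≐ lang D

Class : Set₂
Class = (k : ℕ) → Lang k → Set₁

record IsPositiveVariety (C : Class) : Set₁ where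
  field
    regular    : ∀ {k} {L : Lang k} → C k L → Regular L
    -- languages are sets: membership in C is invariant under equality of languages
    extensional : ∀ {k} {L L′ : Lang k} → C k L → L ≐ L′ → C k L′
    has-∅      : ∀ {k} → C k ∅ₗ
    has-full   : ∀ {k} → C k Fullₗ
    closed-∪   : ∀ {k} {L L′ : Lang k} → C k L → C k L′ → C k (L ∪ₗ L′)
    closed-∩   : ∀ {k} {L L′ : Lang k} → C k L → C k L′ → C k (L ∩ₗ L′)
    closed-leftQuot  : ∀ {k} {L : Lang k} (u : Word k) → C k L → C k (leftQuot u L)
    closed-rightQuot : ∀ {k} {L : Lang k} (u : Word k) → C k L → C k (rightQuot u L)
    closed-preimage  : ∀ {k k′} {L : Lang k′} (α : Morphism k k′) → C k′ L → C k (preimage α L)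

data BExpr (Atom : Set) : Set where
  atom  : Atom → BExpr Atom
  ⊤ᵇ ⊥ᵇ : BExpr Atom
  ¬ᵇ_   : BExpr Atom → BExpr Atom
  _∧ᵇ_ _∨ᵇ_ : BExpr Atom → BExpr Atom → BExpr Atom

⟦_⟧ᵇ : ∀ {k} {Atom : Set} → BExpr Atom → (Atom → Lang k) → Lang k
⟦ atom x ⟧ᵇ σ w = σ x w
⟦ ⊤ᵇ ⟧ᵇ σ w = ⊤
⟦ ⊥ᵇ ⟧ᵇ σ w = ⊥
⟦ ¬ᵇ e ⟧ᵇ σ w = ¬ ⟦ e ⟧ᵇ σ w
⟦ e ∧ᵇ e′ ⟧ᵇ σ w = ⟦ e ⟧ᵇ σ w × ⟦ e′ ⟧ᵇ σ w
⟦ e ∨ᵇ e′ ⟧ᵇ σ w = ⟦ e ⟧ᵇ σ w ⊎ ⟦ e′ ⟧ᵇ σ w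

ModAtom : Set
ModAtom = Σ ℕ Fin

modLang : ∀ {k} → ModAtom → Lang k
modLang (d , m) w = ∃[ q ] length w ≡ toℕ m + q * d

MOD : Class
MOD k L = Lift _ (Σ (BExpr ModAtom) λ e → L ≐ ⟦ e ⟧ᵇ modLang)

suffixLang : ∀ {k} → Word k → Lang k
suffixLang w v = ∃[ u ] v ≡ u ++ w

SU : Class
SU k L = Lift _ (Σ (BExpr (Word k)) λ e → L ≐ ⟦ e ⟧ᵇ suffixLang)

-- Enrichment C ∘ D.
-- A finite partition P of A* with m blocks is given by the function
-- u ↦ index of [u]_P ; block i is {u | blockOf u ≡ i}.
-- The letter (P_i , a) of the alphabet P × A is encoded as combine i a : Fin (m * k).

block : ∀ {k m} → (Word k → Fin m) → Fin m → Lang k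
block f i u = f u ≡ i

record Partition (D : Class) (k : ℕ) : Set₁ where
  field
    m        : ℕ
    blockOf  : Word k → Fin m
    nonempty : ∀ i → ∃[ u ] blockOf u ≡ i
    inD      : ∀ i → D k (block blockOf i)

tagAux : ∀ {k m} → (Word k → Fin m) → Word k → Word k → Word (m * k)
tagAux f p []      = []
tagAux f p (a ∷ w) = combine (f p) a ∷ tagAux f (p ++ [ a ]) w

tag : ∀ {k m} → (Word k → Fin m) → Word k → Word (m * k)
tag f w = tagAux f [] w

Liftable : (C : Class) {k m : ℕ} → (Word k → Fin m) → Lang k → Set₁
Liftable C {k} {m} f L =
  Σ (Fin m → Lang (m * k)) λ Lp →
    (∀ i → C (m * k) (Lp i)) ×
    (L ≐ λ w → Σ (Fin m) λ i → Lp i (tag f w) × block f i w)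

_∘ᶜ_ : Class → Class → Class
(C ∘ᶜ D) k L = Σ (Partition D k) λ P → Liftable C (Partition.blockOf P) L

Coverable : Class → (k : ℕ) → Lang k → List (Lang k) → Set₁
Coverable C k L₁ L₂ =
  Σ (List (Lang k)) λ K →
    All (C k) K ×
    (∀ w → L₁ w → Any (λ K′ → K′ w) K) ×
    All (λ K′ → Any (λ L → Disjoint K′ L) L₂) K

Separable : Class → (k : ℕ) → Lang k → Lang k → Set₁
Separable C k L₁ L₂ =
  Σ (Lang k) λ K → C k K × (∀ w → L₁ w → K w) × Disjoint K L₂

CoveringDecidable : Class → Set₁
CoveringDecidable C =
  ∀ k (A₁ : DFA k) (A₂ : List (DFA k)) →
    Dec (Coverable C k (lang A₁) (Data.List.map lang A₂))

SeparationDecidable : Class → Set₁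
SeparationDecidable C =
  ∀ k (A₁ A₂ : DFA k) → Dec (Separable C k (lang A₁) (lang A₂))

{-# OPTIONS --safe #-}
module Submission where

-- Write D = C ∘ SU. Let N bound the number of transition maps of the given automata and s = N !.
-- Then s is a multiple of the length of any loop found in a word of length s, so such a word can
-- be pumped to length s (d + 1), for every d, without changing its transition map. The reduction
-- replaces each language by its image under tagging every letter with its position modulo s.
-- Tagging pulls D back into D ∘ MOD. Conversely, given finitely many languages of D ∘ MOD with a
-- common modulus d + 1, pump every complete block of s letters to length s (d + 1): pumped blocks
-- are invisible modulo d + 1, and on tagged words this operation is computed from suffixes of
-- bounded length, hence it is a morphism after an SU enrichment and pulls D ∘ MOD back into D.
-- The morphism erases the letters inside a block, so C must be closed under erasing morphisms.

open import Defs
open import Level using (lift; lower)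
open import Data.Bool using (false; T)
open import Data.Empty using (⊥-elim)
open import Data.Fin using (Fin; zero; suc; toℕ; combine; remQuot; finToFun; funToFin)
import Data.Fin as Fin
open import Data.Fin.Properties using
  (remQuot-combine; combine-remQuot; combine-injectiveˡ; combine-injectiveʳ;
   finToFun-funToFin; pigeonhole; toℕ<n; toℕ-fromℕ<; toℕ-injective)
open import Data.List using
  (List; []; _∷_; _++_; [_]; length; foldl; foldr; map; reverse; take; drop;
   allFin; replicate; _ʳ++_)
open import Data.List.Properties
open import Data.List.Membership.Propositional.Properties using (∈-allFin)
open import Data.List.Membership.Propositional using (lose)
open import Data.List.Relation.Unary.All using (All; []; _∷_)
import Data.List.Relation.Unary.All as All
open import Data.List.Relation.Unary.Any using (Any; here; there)
import Data.List.Relation.Unary.Any as Any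
import Data.List.Relation.Unary.Any.Properties as Any
open import Data.Nat using
  (ℕ; zero; suc; _+_; _*_; _∸_; _^_; _!; _≤_; _<_; _≟_; NonZero; z≤n; s≤s; s≤s⁻¹;
   ≢-nonZero⁻¹; >-nonZero; >-nonZero⁻¹)
open import Data.Nat.DivMod using
  (_%_; _/_; _mod_; m≡m%n+[m/n]*n; m%n<n; m<n⇒m%n≡m; m*n%n≡0; [m+n]%n≡m%n; [m+kn]%n≡m%n)
open import Data.Nat.Divisibility using (_∣_; divides; m≤n⇒m!∣n!; ∣-trans; m∣m*n)
open import Data.Nat.Properties
open import Data.Product using (Σ; ∃; _×_; _,_; proj₁; proj₂)
open import Data.Sum using (_⊎_; inj₁; inj₂)
import Data.Sum as Sum
open import Function using (_∘_; id)
open import Relation.Binary.PropositionalEquality hiding ([_])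
open import Relation.Nullary using (¬_; Dec; yes; no; contradiction)
open import Relation.Nullary.Decidable using (map′)

-- Boolean combinations and partitions invariant under a scaled family of relations

Invariant : ∀ {k} → (Word k → Word k → Set) → Lang k → Set
Invariant _~_ L = ∀ {u v} → u ~ v → (L u → L v) × (L v → L u)

-- The operation joins two scales: it is `_⊛_` for moduli and addition for suffix lengths.
Inherited : (ℕ → ℕ → ℕ) → (ℕ → Set) → Set
Inherited _⊕_ P = ∀ {m n} → (P m → P (m ⊕ n)) × (P n → P (m ⊕ n))

uniform : ∀ _⊕_ {m} {P : Fin m → ℕ → Set} → (∀ i → Inherited _⊕_ (P i)) →
  (∀ i → ∃ (P i)) → ∃ λ n → ∀ i → P i n
uniform _⊕_ {zero} inh ex = 0 , λ ()
uniform _⊕_ {suc m} inh ex with ex zero | uniform _⊕_ (inh ∘ suc) (ex ∘ suc)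
... | a , pa | b , pb = a ⊕ b , λ where
  zero    → proj₁ (inh zero) pa
  (suc i) → proj₂ (inh (suc i)) (pb i)

module _ {k : ℕ} (_⊕_ : ℕ → ℕ → ℕ) (R : ℕ → Word k → Word k → Set)
  (refine : ∀ {m n u v} → R (m ⊕ n) u v → R m u v × R n u v) where

  invariant-inherited : {L : Lang k} → Inherited _⊕_ (λ n → Invariant (R n) L)
  invariant-inherited = (λ inv r → inv (proj₁ (refine r))) , (λ inv r → inv (proj₂ (refine r)))

  -- Induction on the expression: constants hold at any scale, negation keeps the scale and swaps
  -- the two directions, and binary connectives join scales.
  expr-invariant : ∀ {Atom : Set} {σ : Atom → Lang k} →
    (∀ x → ∃ λ n → Invariant (R n) (σ x)) → ∀ e → ∃ λ n → Invariant (R n) (⟦ e ⟧ᵇ σ)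
  expr-invariant at (atom x) = at x
  expr-invariant at ⊤ᵇ = 0 , λ _ → id , id
  expr-invariant at ⊥ᵇ = 0 , λ _ → id , id
  expr-invariant at (¬ᵇ e) with expr-invariant at e
  ... | n , inv = n , λ r → (_∘ proj₂ (inv r)) , (_∘ proj₁ (inv r))
  expr-invariant at (e ∧ᵇ e′) with expr-invariant at e | expr-invariant at e′
  ... | m , inv | n , inv′ = m ⊕ n , λ r → let r₁ , r₂ = refine r in
    Data.Product.map (proj₁ (inv r₁)) (proj₁ (inv′ r₂)) ,
    Data.Product.map (proj₂ (inv r₁)) (proj₂ (inv′ r₂))
  expr-invariant at (e ∨ᵇ e′) with expr-invariant at e | expr-invariant at e′
  ... | m , inv | n , inv′ = m ⊕ n , λ r → let r₁ , r₂ = refine r in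
    Sum.map (proj₁ (inv r₁)) (proj₁ (inv′ r₂)) ,
    Sum.map (proj₂ (inv r₁)) (proj₂ (inv′ r₂))

  partition-invariant : ∀ {Atom : Set} {σ : Atom → Lang k} →
    (∀ x → ∃ λ n → Invariant (R n) (σ x)) →
    ∀ {m} (f : Word k → Fin m) → (∀ i → Σ (BExpr Atom) λ e → block f i ≐ ⟦ e ⟧ᵇ σ) →
    ∃ λ n → ∀ {u v} → R n u v → f u ≡ f v
  partition-invariant {σ = σ} at f blocks =
    let n , inv = uniform _⊕_ (λ i → invariant-inherited) block-invariant
    in n , λ {u} {v} r → sym (proj₁ (inv (f u) r) refl)
    where
    block-invariant : ∀ i → ∃ λ n → Invariant (R n) (block f i)
    block-invariant i with blocks i
    ... | e , eq with expr-invariant at e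
    ...   | n , inv = n , λ {u} {v} r →
      proj₂ (eq v) ∘ proj₁ (inv r) ∘ proj₁ (eq u) , proj₂ (eq u) ∘ proj₂ (inv r) ∘ proj₁ (eq v)

-- Length modulo an integer

module _ {k d : ℕ} .{{_ : NonZero d}} where

  modLang⇒% : ∀ {m : Fin d} (u : Word k) → modLang (d , m) u → length u % d ≡ toℕ m
  modLang⇒% {m} u (q , eq) =
    trans (cong (_% d) eq) (trans ([m+kn]%n≡m%n (toℕ m) q d) (m<n⇒m%n≡m (toℕ<n m)))

  %⇒modLang : ∀ {m : Fin d} (u : Word k) → length u % d ≡ toℕ m → modLang (d , m) u
  %⇒modLang u eq =
    length u / d , trans (m≡m%n+[m/n]*n (length u) d) (cong (_+ length u / d * d) eq)

-- The modulus is the successor of the scale, so that it is never zero.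
ModEquiv : ∀ {k} → ℕ → Word k → Word k → Set
ModEquiv d u v = ∃ λ q → length u ≡ length v + q * suc d

-- Chosen so that `suc (m ⊛ n)` is `suc m * suc n` by definition: the joined modulus is the product.
_⊛_ : ℕ → ℕ → ℕ
m ⊛ n = n + m * suc n

modEquiv-refine : ∀ {k m n} {u v : Word k} →
  ModEquiv (m ⊛ n) u v → ModEquiv m u v × ModEquiv n u v
modEquiv-refine {m = m} {n} {v = v} (q , eq) =
  (q * suc n , trans eq (cong (length v +_)
    (trans (cong (q *_) (*-comm (suc m) (suc n))) (sym (*-assoc q (suc n) (suc m)))))) ,
  (q * suc m , trans eq (cong (length v +_) (sym (*-assoc q (suc m) (suc n)))))

modLang-invariant : ∀ {k} (x : ModAtom) → ∃ λ d → Invariant (ModEquiv {k} d) (modLang x)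
modLang-invariant (suc d , m) = d , λ {u} {v} (q , eq) →
  let eq% = trans (cong (_% suc d) eq) ([m+kn]%n≡m%n (length v) q (suc d)) in
  (λ l → %⇒modLang v (trans (sym eq%) (modLang⇒% u l))) ,
  (λ l → %⇒modLang u (trans eq% (modLang⇒% v l)))

Periodic : ∀ {k} {X : Set} → ℕ → (Word k → X) → Set
Periodic d f = ∀ u v → ModEquiv d u v → f u ≡ f v

periodic : ∀ {k} (P : Partition MOD k) → ∃ λ d → Periodic d (Partition.blockOf P)
periodic P = let d , inv = partition-invariant _⊛_ ModEquiv
                    (λ {m} {n} {u} {v} → modEquiv-refine {m = m} {n} {u} {v})
                    modLang-invariant (Partition.blockOf P) (lower ∘ Partition.inD P)
             in d , λ _ _ → inv

-- Suffixes

-- A word is related to its own suffix rather than to another word with the same ending, since later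
-- a word is only compared with a truncation of itself.
LongSuffix : ∀ {k} → ℕ → Word k → Word k → Set
LongSuffix h w u = h ≤ length u × ∃ λ p → w ≡ p ++ u

longSuffix-refine : ∀ {k m n} {w u : Word k} →
  LongSuffix (m + n) w u → LongSuffix m w u × LongSuffix n w u
longSuffix-refine {m = m} {n} (h≤ , suf) = (m+n≤o⇒m≤o m h≤ , suf) , (m+n≤o⇒n≤o m h≤ , suf)

-- Letters are stripped from `p` and `x` in parallel. `x` cannot run out first, since `w` would then
-- be longer than `u`.
++-suffix : ∀ {A : Set} (p : List A) {u x w : List A} → length w ≤ length u →
  p ++ u ≡ x ++ w → ∃ λ y → u ≡ y ++ w
++-suffix [] _ eq = _ , eq
++-suffix (a ∷ p) {u} {[]} le eq = contradiction le (<⇒≱ (≤-trans (s≤s (m≤n+m (length u) (length p)))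
  (≤-reflexive (trans (cong suc (sym (length-++ p))) (cong length eq)))))
++-suffix (a ∷ p) {u} {b ∷ x} le eq = ++-suffix p le (∷-injectiveʳ eq)

suffixLang-invariant : ∀ {k} (w : Word k) → ∃ λ h → Invariant (LongSuffix h) (suffixLang w)
suffixLang-invariant w = length w , λ where
  (le , p , refl) →
    (λ (x , eq) → ++-suffix p le eq) , (λ (y , eq) → p ++ y , trans (cong (p ++_) eq) (sym (++-assoc p y w)))

Suffixal : ∀ {k} {X : Set} → ℕ → (Word k → X) → Set
Suffixal h f = ∀ w u → LongSuffix h w u → f w ≡ f u

suffixal : ∀ {k} (P : Partition SU k) → ∃ λ h → Suffixal h (Partition.blockOf P)
suffixal P = let h , inv = partition-invariant _+_ LongSuffix longSuffix-refine
                    suffixLang-invariant (Partition.blockOf P) (lower ∘ Partition.inD P)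
             in h , λ _ _ → inv

-- The partition by the last letters

suf : ∀ {k} → ℕ → Word k → Word k
suf h w = reverse (take h (reverse w))

-- Words are read from right to left: the code of the reversal of w determines suf h w.
codes : ℕ → ℕ → ℕ
codes k zero    = 1
codes k (suc h) = suc (k * codes k h)

-- At positive depth `zero` means that the word has ended; at depth `0` it means that the rest is
-- left unread. Thus `codes k h` counts the words of length at most `h`.
code : ∀ {k} h → Word k → Fin (codes k h)
code zero    r       = zero
code (suc h) []      = zero
code (suc h) (a ∷ r) = suc (combine a (code h r))

decode : ∀ {k} h → Fin (codes k h) → Word k
decode zero i = []
decode (suc h) zero = []
decode {k} (suc h) (suc i) =
  let a , j = remQuot {k} (codes k h) i in a ∷ decode h j

decode-code : ∀ {k} h (r : Word k) → decode h (code h r) ≡ take h r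
decode-code zero    r       = refl
decode-code (suc h) []      = refl
decode-code {k} (suc h) (a ∷ r) = trans
  (cong (λ x → proj₁ x ∷ decode h (proj₂ x)) (remQuot-combine {k} a (code h r)))
  (cong (a ∷_) (decode-code h r))

-- This makes every block of `suffixPartition` nonempty.
code-decode : ∀ {k} h (i : Fin (codes k h)) → code h (decode {k} h i) ≡ i
code-decode zero    zero = refl
code-decode (suc h) zero = refl
code-decode {k} (suc h) (suc i) = cong suc (trans
  (cong (combine {k} _) (code-decode {k} h _)) (combine-remQuot {k} (codes k h) i))

⋁ᵇ : ∀ {Atom : Set} → List Atom → BExpr Atom
⋁ᵇ = foldr (λ x e → atom x ∨ᵇ e) ⊥ᵇ

⋁ᵇ-sound : ∀ {k} {Atom : Set} {σ : Atom → Lang k} {w} xs →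
  ⟦ ⋁ᵇ xs ⟧ᵇ σ w → Any (λ x → σ x w) xs
⋁ᵇ-sound (x ∷ xs) (inj₁ h) = here h
⋁ᵇ-sound (x ∷ xs) (inj₂ h) = there (⋁ᵇ-sound xs h)

⋁ᵇ-complete : ∀ {k} {Atom : Set} {σ : Atom → Lang k} {w} {xs} →
  Any (λ x → σ x w) xs → ⟦ ⋁ᵇ xs ⟧ᵇ σ w
⋁ᵇ-complete (here h)  = inj₁ h
⋁ᵇ-complete (there h) = inj₂ (⋁ᵇ-complete h)

extensions : ∀ {k} → Word k → List (Word k)
extensions {k} w = map (_∷ w) (allFin k)

-- `w` accumulates the suffix already read, and `i` codes the letters before it. At positive depth,
-- `zero` expresses that the word is exactly `w`: it ends in `w` but in no one-letter extension of
-- `w`.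
codeExpr : ∀ {k} h → Word k → Fin (codes k h) → BExpr (Word k)
codeExpr zero w i = atom w
codeExpr (suc h) w zero = atom w ∧ᵇ (¬ᵇ ⋁ᵇ (extensions w))
codeExpr {k} (suc h) w (suc i) =
  let a , j = remQuot {k} (codes k h) i in codeExpr h (a ∷ w) j

∷-not-suffix : ∀ {k} (x : Word k) {a w} → ¬ (w ≡ x ++ a ∷ w)
∷-not-suffix x {a} {w} eq = <-irrefl (cong length eq)
  (≤-trans (m≤n+m (suc (length w)) (length x)) (≤-reflexive (sym (length-++ x))))

codeExpr-sound : ∀ {k} h (w r : Word k) → ⟦ codeExpr h w (code h r) ⟧ᵇ suffixLang (r ʳ++ w)
codeExpr-sound zero w r = reverse r , ʳ++-defn r
codeExpr-sound (suc h) w [] = ([] , refl) , λ ext →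
  let a , x , eq = Any.satisfied (Any.map⁻ (⋁ᵇ-sound (extensions w) ext)) in ∷-not-suffix x eq
codeExpr-sound {k} (suc h) w (a ∷ r) = subst
  (λ x → ⟦ codeExpr h (proj₁ x ∷ w) (proj₂ x) ⟧ᵇ suffixLang (r ʳ++ (a ∷ w)))
  (sym (remQuot-combine {k} a (code h r))) (codeExpr-sound h (a ∷ w) r)

codeExpr-complete : ∀ {k} h (w : Word k) i {v} → ⟦ codeExpr h w i ⟧ᵇ suffixLang v →
  ∃ λ r → v ≡ r ʳ++ w × code h r ≡ i
codeExpr-complete zero w zero (u , eq) = reverse u ,
  trans eq (sym (trans (ʳ++-defn (reverse u)) (cong (_++ w) (reverse-involutive u)))) , refl
codeExpr-complete (suc h) w zero {v} ((u , eq) , ¬ext) = exact (reverse u)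
  (trans eq (sym (trans (ʳ++-defn (reverse u)) (cong (_++ w) (reverse-involutive u)))))
  where
  exact : ∀ r → v ≡ r ʳ++ w → ∃ λ r → v ≡ r ʳ++ w × code (suc h) r ≡ zero
  exact []      eq = [] , eq , refl
  exact (a ∷ r) eq = contradiction
    (⋁ᵇ-complete (Any.map⁺ (lose (∈-allFin a) (reverse r , trans eq (ʳ++-defn r))))) ¬ext
codeExpr-complete {k} (suc h) w (suc i) sat
  with codeExpr-complete {k} h (_ ∷ w) (proj₂ (remQuot {k} (codes k h) i)) sat
... | r , eq , ceq = _ ∷ r , eq ,
  cong suc (trans (cong (combine {k} _) ceq) (combine-remQuot {k} (codes k h) i))

suffixPartition : ∀ k (h : ℕ) → Partition SU k
suffixPartition k h = record
  { m        = codes k h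
  ; blockOf  = code h ∘ reverse
  ; nonempty = λ i → reverse (decode h i) ,
      trans (cong (code h) (reverse-involutive (decode h i))) (code-decode {k} h i)
  ; inD      = λ i → lift (codeExpr h [] i , λ w →
      (λ { refl → subst (⟦ codeExpr h [] (code h (reverse w)) ⟧ᵇ suffixLang) (reverse-involutive w)
                    (codeExpr-sound h [] (reverse w)) }) ,
      (λ sat → let r , eq , ceq = codeExpr-complete h [] i sat in
        trans (cong (code h) (trans (cong reverse eq) (reverse-involutive r))) ceq))
  }

-- Transductions with bounded memory

module _ {k k′ : ℕ} (o : Word k → Fin k → Word k′) where

  transduce : Word k → Word k → Word k′
  transduce p []      = []
  transduce p (a ∷ w) = o p a ++ transduce (p ++ [ a ]) w

module _ {k k′ : ℕ} (h : ℕ) (o : Word k → Fin k → Word k′) where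

  suffixMorphism : Morphism (codes k h * k) k′
  suffixMorphism c = let i , a = remQuot {codes k h} k c in o (reverse (decode h i)) a

  -- The tag of a letter codes the last `h` letters before it, which is all that the output depends
  -- on besides the letter itself.
  applyMor-tag : ∀ p w → applyMor suffixMorphism (tagAux (code h ∘ reverse) p w) ≡
    transduce (o ∘ suf h) p w
  applyMor-tag p []      = refl
  applyMor-tag p (a ∷ w) = cong₂ _++_
    (trans (cong (λ x → o (reverse (decode h (proj₁ x))) (proj₂ x))
              (remQuot-combine {codes k h} (code h (reverse p)) a))
           (cong (λ q → o (reverse q) a) (decode-code h (reverse p))))
    (applyMor-tag (p ++ [ a ]) w)

module PositiveVariety {C : Class} (V : IsPositiveVariety C) where
  open IsPositiveVariety V

  -- The output alphabet, the output function and the target language may all depend on the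
  -- last h letters e of the whole word, as liftability allows one language per block.
  transduce-∘SU : ∀ {k} h (κ : Word k → ℕ) (o : ∀ e → Word k → Fin k → Word (κ e))
    (M : ∀ e → Lang (κ e)) → (∀ e → C (κ e) (M e)) →
    (C ∘ᶜ SU) k (λ w → M (suf h w) (transduce (o (suf h w) ∘ suf h) [] w))
  transduce-∘SU {k} h κ o M M∈C =
    suffixPartition k h ,
    (λ i → preimage (suffixMorphism h (o (end i))) (M (end i))) ,
    (λ i → closed-preimage (suffixMorphism h (o (end i))) (M∈C (end i))) ,
    λ w → (λ x → code h (reverse w) , proj₂ (agree w) x , refl) ,
          (λ { (_ , x , refl) → proj₁ (agree w) x })
    where
    end : Fin (codes k h) → Word k
    end i = reverse (decode h i)

    agree : ∀ w → let i = code h (reverse w) in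
      (M (end i) (applyMor (suffixMorphism h (o (end i))) (tag (code h ∘ reverse) w)) →
       M (suf h w) (transduce (o (suf h w) ∘ suf h) [] w)) ×
      (M (suf h w) (transduce (o (suf h w) ∘ suf h) [] w) →
       M (end i) (applyMor (suffixMorphism h (o (end i))) (tag (code h ∘ reverse) w)))
    -- After this rewriting `end i` is `suf h w` by definition, so that the dependent alphabets `κ`
    -- on both sides coincide.
    agree w rewrite decode-code h (reverse w) =
      subst (M (suf h w)) (applyMor-tag h (o (suf h w)) [] w) ,
      subst (M (suf h w)) (sym (applyMor-tag h (o (suf h w)) [] w))

-- Tagging

tagAux-++ : ∀ {k m} (f : Word k → Fin m) p u v →
  tagAux f p (u ++ v) ≡ tagAux f p u ++ tagAux f (p ++ u) v
tagAux-++ f p []      v = cong (λ q → tagAux f q v) (sym (++-identityʳ p))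
tagAux-++ f p (a ∷ u) v = cong (_ ∷_) (trans (tagAux-++ f (p ++ [ a ]) u v)
  (cong (λ q → tagAux f (p ++ [ a ]) u ++ tagAux f q v) (++-assoc p [ a ] u)))

length-tagAux : ∀ {k m} (f : Word k → Fin m) p u → length (tagAux f p u) ≡ length u
length-tagAux f p []      = refl
length-tagAux f p (a ∷ u) = cong suc (length-tagAux f (p ++ [ a ]) u)

-- Tagging sees the left context only through the values of `f` on its extensions.
tagAux-cong : ∀ {k m} (f : Word k → Fin m) {p q} → (∀ y → f (p ++ y) ≡ f (q ++ y)) →
  ∀ u → tagAux f p u ≡ tagAux f q u
tagAux-cong f eq []      = refl
tagAux-cong f {p} {q} eq (a ∷ u) = cong₂ (λ i v → combine i a ∷ v)
  (trans (cong f (sym (++-identityʳ p))) (trans (eq []) (cong f (++-identityʳ q))))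
  (tagAux-cong f (λ y → trans (cong f (++-assoc p [ a ] y))
    (trans (eq (a ∷ y)) (cong f (sym (++-assoc q [ a ] y))))) u)

module Residue {k : ℕ} (s : ℕ) .{{_ : NonZero s}} where

  residue : Word k → Fin s
  residue w = length w mod s

  next : Fin s → Fin s
  next r = suc (toℕ r) mod s

  toℕ-mod : ∀ n → toℕ (n mod s) ≡ n % s
  toℕ-mod n = toℕ-fromℕ< (m%n<n n s)

  next-mod : ∀ n → next (n mod s) ≡ suc n mod s
  next-mod n = toℕ-injective (trans (toℕ-mod (suc (toℕ (n mod s)))) (trans
    (cong (λ x → suc x % s) (toℕ-mod n)) (trans (suc-% n) (sym (toℕ-mod (suc n))))))
    where
    suc-% : ∀ n → suc (n % s) % s ≡ suc n % s
    suc-% n = sym (trans (cong (λ x → suc x % s) (m≡m%n+[m/n]*n n s))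
                         ([m+kn]%n≡m%n (suc (n % s)) (n / s) s))

  residue-∷ʳ : ∀ w a → residue (w ++ [ a ]) ≡ next (residue w)
  residue-∷ʳ w a = trans (cong (_mod s) (trans (length-++ w) (+-comm (length w) 1)))
                         (sym (next-mod (length w)))

  tagged : Word k → Word (s * k)
  tagged = tag residue

  -- Residue classes are atoms of `MOD`, and the same `K` serves every block. The hypothesis on
  -- words makes the blocks nonempty; over the empty alphabet it forces `s` to be 1.
  tagged-∘MOD : ∀ (D : Class) → (∀ (r : Fin s) → ∃ λ (w : Word k) → length w ≡ toℕ r) →
    ∀ {K} → D (s * k) K → (D ∘ᶜ MOD) k (K ∘ tagged)
  tagged-∘MOD D words {K} K∈D =
    record
      { m        = s
      ; blockOf  = residue
      ; nonempty = λ r → let w , eq = words r in w , toℕ-injective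
          (trans (toℕ-mod (length w)) (trans (cong (_% s) eq) (m<n⇒m%n≡m (toℕ<n r))))
      ; inD      = λ r → lift (atom (s , r) , λ w →
          (λ eq → %⇒modLang w (trans (sym (toℕ-mod (length w))) (cong toℕ eq))) ,
          (λ l → toℕ-injective (trans (toℕ-mod (length w)) (modLang⇒% w l))))
      } ,
    (λ _ → K) , (λ _ → K∈D) , λ w → (λ x → residue w , x , refl) , (λ (_ , x , _) → x)

-- Pumping complete blocks

SameRun : ∀ {k} → DFA k → Word k → Word k → Set
SameRun A u v = ∀ q → run A q u ≡ run A q v

sameRun-++ : ∀ {k} (A : DFA k) {u u′ v v′} →
  SameRun A u u′ → SameRun A v v′ → SameRun A (u ++ v) (u′ ++ v′)
sameRun-++ A {u} {u′} {v} {v′} p r q = trans (foldl-++ (δ A) q u v)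
  (trans (cong (λ q → run A q v) (p q)) (trans (r (run A q u′)) (sym (foldl-++ (δ A) q u′ v′))))

suf-split : ∀ {k} n (w : Word k) → ∃ λ p → w ≡ p ++ suf n w × (p ≡ [] ⊎ length (suf n w) ≡ n)
suf-split n w = reverse (drop n (reverse w)) ,
  trans (sym (reverse-involutive w))
    (trans (cong reverse (sym (take++drop≡id n (reverse w))))
           (reverse-++ (take n (reverse w)) (drop n (reverse w)))) ,
  Sum.map (λ w≤n → cong reverse (drop-all n (reverse w) (≤-trans (≤-reflexive (length-reverse w)) w≤n)))
    (λ n≤w → trans (length-reverse (take n (reverse w))) (trans (length-take n (reverse w))
      (m≤n⇒m⊓n≡m (≤-trans n≤w (≤-reflexive (sym (length-reverse w)))))))
    (≤-total (length w) n)

module Blocks {k : ℕ} (s : ℕ) .{{_ : NonZero s}} (β : Word k → Word k) where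

  -- `t` is the incomplete block read so far; it is flushed through `β` when it reaches `s` letters.
  -- The decision is a separate argument so that proofs can split on it.
  stepIf : (t : Word k) → Fin k → Dec (suc (length t) ≡ s) → Word k
  stepIf t a (yes _) = []
  stepIf t a (no _)  = t ++ [ a ]

  emitIf : (t : Word k) → Fin k → Dec (suc (length t) ≡ s) → Word k
  emitIf t a (yes _) = β (t ++ [ a ])
  emitIf t a (no _)  = []

  step emit : Word k → Fin k → Word k
  step t a = stepIf t a (suc (length t) ≟ s)
  emit t a = emitIf t a (suc (length t) ≟ s)

  emitted : Word k → Word k → Word k
  emitted t []      = []
  emitted t (a ∷ w) = emit t a ++ emitted (step t a) w

  pending base pumped : Word k → Word k
  pending  = foldl step []
  base     = emitted []
  pumped w = base w ++ pending w

  emitted-++ : ∀ t u v → emitted t (u ++ v) ≡ emitted t u ++ emitted (foldl step t u) v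
  emitted-++ t []      v = refl
  emitted-++ t (a ∷ u) v =
    trans (cong (emit t a ++_) (emitted-++ (step t a) u v)) (sym (++-assoc (emit t a) _ _))

  base-∷ʳ : ∀ w a → base (w ++ [ a ]) ≡ base w ++ emit (pending w) a
  base-∷ʳ w a = trans (emitted-++ [] w [ a ]) (cong (base w ++_) (++-identityʳ _))

  length-foldl-step : ∀ t w → length t < s → length (foldl step t w) ≡ (length t + length w) % s
  length-foldl-step t [] t<s =
    sym (trans (cong (_% s) (+-identityʳ (length t))) (m<n⇒m%n≡m t<s))
  length-foldl-step t (a ∷ w) t<s = onStep (suc (length t) ≟ s)
    where
    onStep : ∀ d → length (foldl step (stepIf t a d) w) ≡ (length t + suc (length w)) % s
    onStep (yes eq) = trans (length-foldl-step [] w (>-nonZero⁻¹ s)) (sym (trans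
      (cong (_% s) (trans (+-suc (length t) (length w))
        (trans (cong (_+ length w) eq) (+-comm s (length w)))))
      ([m+n]%n≡m%n (length w) s)))
    onStep (no neq) = trans
      (length-foldl-step (t ++ [ a ]) w (≤-trans (s≤s (≤-reflexive len)) (≤∧≢⇒< t<s neq)))
      (cong (_% s) (trans (cong (_+ length w) len) (sym (+-suc (length t) (length w)))))
      where
      len : length (t ++ [ a ]) ≡ suc (length t)
      len = trans (length-++ t) (+-comm (length t) 1)

  length-pending : ∀ w → length (pending w) ≡ length w % s
  length-pending w = length-foldl-step [] w (>-nonZero⁻¹ s)

  pending-[] : ∀ w → length w % s ≡ 0 → pending w ≡ []
  pending-[] w eq = empty (pending w) (trans (length-pending w) eq)
    where
    empty : ∀ (u : Word k) → length u ≡ 0 → u ≡ []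
    empty [] _ = refl

  pumped-sameRun : ∀ (A : DFA k) → (∀ b → length b ≡ s → SameRun A b (β b)) →
    ∀ w → SameRun A w (pumped w)
  pumped-sameRun A β-sameRun = go []
    where
    -- Generalised to a scan that starts with the incomplete block `t`, already read but not yet
    -- emitted.
    go : ∀ t w → SameRun A (t ++ w) (emitted t w ++ foldl step t w)
    go t []      q = cong (run A q) (++-identityʳ t)
    go t (a ∷ w) q = trans (cong (run A q) (sym (++-assoc t [ a ] w))) (trans
      (onStep (suc (length t) ≟ s) q)
      (cong (run A q) (sym (++-assoc (emit t a) (emitted (step t a) w) _))))
      where
      onStep : ∀ d → SameRun A ((t ++ [ a ]) ++ w)
        (emitIf t a d ++ (emitted (stepIf t a d) w ++ foldl step (stepIf t a d) w))
      onStep (yes eq) = sameRun-++ A {t ++ [ a ]} {β (t ++ [ a ])} {w}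
        (β-sameRun (t ++ [ a ]) (trans (length-++ t) (trans (+-comm (length t) 1) eq))) (go [] w)
      onStep (no _)   = go (t ++ [ a ]) w

  module Multiples (d : ℕ) (length-β : ∀ b → length b ≡ s → length (β b) ≡ s * suc d) where

    length-emit : ∀ t a → ∃ λ q → length (emit t a) ≡ q * suc d
    length-emit t a = onStep (suc (length t) ≟ s)
      where
      onStep : ∀ e → ∃ λ q → length (emitIf t a e) ≡ q * suc d
      onStep (yes eq) = s , length-β (t ++ [ a ]) (trans (length-++ t) (trans (+-comm (length t) 1) eq))
      onStep (no _)   = 0 , refl

    length-emitted : ∀ t w → ∃ λ q → length (emitted t w) ≡ q * suc d
    length-emitted t []      = 0 , refl
    length-emitted t (a ∷ w) with length-emit t a | length-emitted (step t a) w
    ... | q , eq | q′ , eq′ = q + q′ , trans (length-++ (emit t a))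
      (trans (cong₂ _+_ eq eq′) (sym (*-distribʳ-+ (suc d) q q′)))

    -- A block of `s` letters becomes `s * suc d` letters, so nothing gets shorter. This will bound
    -- the base of a window from below.
    length-≤-emitted : ∀ t w → length t + length w ≤ length (emitted t w) + length (foldl step t w)
    length-≤-emitted t []      = ≤-reflexive (+-identityʳ (length t))
    length-≤-emitted t (a ∷ w) = ≤-trans (onStep (suc (length t) ≟ s))
      (≤-reflexive (trans (sym (+-assoc (length (emit t a)) _ _))
        (cong (_+ length (foldl step (step t a) w)) (sym (length-++ (emit t a))))))
      where
      onStep : ∀ e → length t + suc (length w) ≤
        length (emitIf t a e) + (length (emitted (stepIf t a e) w) + length (foldl step (stepIf t a e) w))
      onStep (yes eq) = ≤-trans
        (≤-reflexive (trans (+-suc (length t) (length w)) (cong (_+ length w) eq)))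
        (+-mono-≤ (≤-trans (m≤m*n s (suc d)) (≤-reflexive (sym
            (length-β (t ++ [ a ]) (trans (length-++ t) (trans (+-comm (length t) 1) eq))))))
          (length-≤-emitted [] w))
      onStep (no _)   = ≤-trans (≤-reflexive (trans (+-suc (length t) (length w))
          (cong (_+ length w) (sym (trans (length-++ t) (+-comm (length t) 1))))))
        (length-≤-emitted (t ++ [ a ]) w)

    -- The length of `base w` is a multiple of `suc d`, hence invisible to `f`.
    base-periodic : ∀ {X : Set} {f : Word k → X} → Periodic d f → ∀ w y → f (base w ++ y) ≡ f y
    base-periodic per w y = let q , eq = length-emitted [] w in per (base w ++ y) y
      (q , trans (length-++ (base w)) (trans (+-comm (length (base w)) (length y))
        (cong (length y +_) eq)))

    -- One block more than h, as the last letters of the window may be pending.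
    window : ℕ → ℕ → ℕ
    window h r = suc h * s + r

    -- The window length is congruent to `length w` modulo `s`, so that whatever is cut off consists
    -- of complete blocks.
    recent : ℕ → Word k → Word k
    recent h w = suf (window h (length w % s)) w

    record Recent (h : ℕ) (w : Word k) : Set where
      field
        past    : Word k
        base-≡  : base w ≡ base past ++ base (recent h w)
        pending-≡ : pending w ≡ pending (recent h w)
        long    : past ≡ [] ⊎ h ≤ length (base (recent h w))

    recent-split : ∀ h w → Recent h w
    recent-split h w with suf-split (window h (length w % s)) w
    ... | p , eq , alt = record
      { past      = p
      ; base-≡    = trans (cong base eq) (trans (emitted-++ [] p (recent h w))
                      (cong (λ t → base p ++ emitted t (recent h w)) p-complete))
      ; pending-≡ = trans (cong pending eq) (trans (foldl-++ step [] p (recent h w))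
                      (cong (λ t → foldl step t (recent h w)) p-complete))
      ; long      = Sum.map id enough alt
      }
      where
      open ≤-Reasoning
      -- Cancelling `length w % s` from both expressions for `length w` leaves only multiples of `s`
      -- besides `length p`.
      aligned : length (recent h w) ≡ window h (length w % s) → length p % s ≡ 0
      aligned len = trans (sym ([m+kn]%n≡m%n (length p) (suc h) s)) (trans
        (cong (_% s) (+-cancelʳ-≡ (length w % s) _ (length w / s * s) (begin-equality
          length p + suc h * s + length w % s   ≡⟨ +-assoc (length p) _ _ ⟩
          length p + window h (length w % s)    ≡⟨ cong (length p +_) len ⟨
          length p + length (recent h w)        ≡⟨ length-++ p ⟨
          length (p ++ recent h w)              ≡⟨ cong length eq ⟨
          length w                              ≡⟨ m≡m%n+[m/n]*n (length w) s ⟩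
          length w % s + length w / s * s       ≡⟨ +-comm (length w % s) _ ⟩
          length w / s * s + length w % s       ∎)))
        (m*n%n≡0 (length w / s) s))

      p-complete : pending p ≡ []
      p-complete = Sum.[ cong pending , pending-[] p ∘ aligned ]′ alt

      -- At most `s` letters of the window are pending, so its base keeps at least `h * s` letters.
      enough : length (recent h w) ≡ window h (length w % s) → h ≤ length (base (recent h w))
      enough len = ≤-trans (m≤m*n h s) (+-cancelʳ-≤ s (h * s) _ (begin
        h * s + s                               ≡⟨ +-comm (h * s) s ⟩
        suc h * s                               ≤⟨ m≤m+n (suc h * s) (length w % s) ⟩
        window h (length w % s)                 ≡⟨ len ⟨
        length (recent h w)                     ≤⟨ length-≤-emitted [] (recent h w) ⟩
        length (base (recent h w)) + length (pending (recent h w))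
          ≤⟨ +-monoʳ-≤ _ (≤-trans (≤-reflexive (length-pending (recent h w)))
                                  (<⇒≤ (m%n<n (length (recent h w)) s))) ⟩
        length (base (recent h w)) + s          ∎))

    module _ {m : ℕ} {f : Word k → Fin m} (per : Periodic d f) where

      -- As `f` does not see `base w`, the letters after it are tagged as if the word began there.
      tag-base-++ : ∀ w z → tag f (base w ++ z) ≡ tag f (base w) ++ tag f z
      tag-base-++ w z = trans (tagAux-++ f [] (base w) z)
        (cong (tag f (base w) ++_) (tagAux-cong f (base-periodic per w) z))

      -- Either nothing was cut off, or the tagged base of the window is a suffix of the tagged base
      -- of `w` with at least `h` letters, by `tag-base-++`; then `g` sees no further.
      recent-suffixal : ∀ {h} {X : Set} {g : Word (m * k) → X} → Suffixal h g →
        ∀ w z → g (tag f (base w) ++ z) ≡ g (tag f (base (recent h w)) ++ z)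
      recent-suffixal {h} {g = g} gs w z = onLong long
        where
        open Recent (recent-split h w)
        onLong : past ≡ [] ⊎ h ≤ length (base (recent h w)) →
          g (tag f (base w) ++ z) ≡ g (tag f (base (recent h w)) ++ z)
        onLong (inj₁ eq) = cong (λ u → g (tag f u ++ z))
          (trans base-≡ (cong (λ p → base p ++ base (recent h w)) eq))
        onLong (inj₂ le) = gs _ _
          ( ≤-trans le (≤-trans (≤-reflexive (sym (length-tagAux f [] (base (recent h w)))))
              (≤-trans (m≤m+n _ (length z)) (≤-reflexive (sym (length-++ (tag f (base (recent h w))))))))
          , tag f (base past)
          , trans (cong (_++ z) (trans (cong (tag f) base-≡) (tag-base-++ past (base (recent h w)))))
                  (++-assoc (tag f (base past)) _ z))

-- Reading letters and phases off tagged words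

map-suf : ∀ {k k′} (f : Fin k → Fin k′) n w → map f (suf n w) ≡ suf n (map f w)
map-suf f n w = trans (reverse-map f (take n (reverse w)))
  (cong reverse (trans (sym (take-map n (reverse w))) (cong (take n) (reverse-map f w))))

suf-suf : ∀ {k m n} → m ≤ n → (w : Word k) → suf m (suf n w) ≡ suf m w
suf-suf {m = m} {n} m≤n w = cong reverse (trans
  (cong (take m) (reverse-involutive (take n (reverse w))))
  (trans (take-take m n (reverse w)) (cong (λ l → take l (reverse w)) (m≤n⇒m⊓n≡m m≤n))))

module _ {k : ℕ} (s : ℕ) .{{_ : NonZero s}} where
  open Residue {k} s

  untag : Word (s * k) → Word k
  untag = map (λ c → proj₂ (remQuot {s} k c))

  untag-tagAux : ∀ p w → untag (tagAux residue p w) ≡ w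
  untag-tagAux p []      = refl
  untag-tagAux p (a ∷ w) =
    cong₂ _∷_ (cong proj₂ (remQuot-combine {s} (residue p) a)) (untag-tagAux (p ++ [ a ]) w)

  -- The previous state is ignored: the tag of the last letter alone gives the length modulo `s`.
  -- The fold only adds a value for the empty word.
  nextPhase : ℕ → Fin (s * k) → ℕ
  nextPhase _ c = toℕ (next (proj₁ (remQuot {s} k c)))

  phase : Word (s * k) → ℕ
  phase = foldl nextPhase (0 % s)

  phase-tagged : ∀ w → phase (tagged w) ≡ length w % s
  phase-tagged = go []
    where
    go : ∀ p w → foldl nextPhase (length p % s) (tagAux residue p w) ≡ length (p ++ w) % s
    go p []      = cong (λ u → length u % s) (sym (++-identityʳ p))
    go p (a ∷ w) = trans
      (cong (λ n → foldl nextPhase n (tagAux residue (p ++ [ a ]) w))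
        (trans (cong (λ x → toℕ (next (proj₁ x))) (remQuot-combine {s} (residue p) a))
        (trans (cong toℕ (sym (residue-∷ʳ p a))) (toℕ-mod (length (p ++ [ a ]))))))
      (trans (go (p ++ [ a ]) w) (cong (λ u → length u % s) (++-assoc p [ a ] w)))

  phase-suf : ∀ n .{{_ : NonZero n}} e → phase (suf n e) ≡ phase e
  phase-suf n e with suf-split n e
  ... | p , eq , inj₁ refl = cong phase (sym eq)
  ... | p , eq , inj₂ len  = sym (trans (cong phase eq)
    (trans (foldl-++ nextPhase (0 % s) p (suf n e)) (irrelevant (suf n e) len)))
    where
    irrelevant : ∀ {x y} u → length u ≡ n → foldl nextPhase x u ≡ foldl nextPhase y u
    irrelevant []      0≡n = contradiction (sym 0≡n) (≢-nonZero⁻¹ n)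
    irrelevant (c ∷ u) _   = refl

-- Pulling a language back along pumping

module Realise {C : Class} (V : IsPositiveVariety C) {k : ℕ} (s : ℕ) .{{_ : NonZero s}}
  (β : Word k → Word k) (d : ℕ) (length-β : ∀ b → length b ≡ s → length (β b) ≡ s * suc d)
  {K : Lang k} (P : Partition MOD k) (per : Periodic d (Partition.blockOf P))
  (L : Liftable (C ∘ᶜ SU) (Partition.blockOf P) K) where

  open IsPositiveVariety V
  open PositiveVariety V
  open Residue {k} s
  open Blocks s β
  open Multiples d length-β
  open Partition P renaming (blockOf to f)

  Lp : Fin m → Lang (m * k)
  Lp = proj₁ L

  Q : Fin m → Partition SU (m * k)
  Q i = proj₁ (proj₁ (proj₂ L) i)

  n : Fin m → ℕ
  n i = Partition.m (Q i)

  g : ∀ i → Word (m * k) → Fin (n i)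
  g i = Partition.blockOf (Q i)

  Mp : ∀ i → Fin (n i) → Lang (n i * (m * k))
  Mp i = proj₁ (proj₂ (proj₁ (proj₂ L) i))

  Mp∈C : ∀ i j → C (n i * (m * k)) (Mp i j)
  Mp∈C i = proj₁ (proj₂ (proj₂ (proj₁ (proj₂ L) i)))

  -- Both enrichments are unions over disjoint blocks, so only the block of `w`, and then that of
  -- its tagged word, can contribute.
  K-via-Mp : ∀ w → let i = f w ; z = tag f w in
    (Mp i (g i z) (tag (g i) z) → K w) × (K w → Mp i (g i z) (tag (g i) z))
  K-via-Mp w =
    (λ x → proj₂ (proj₂ (proj₂ L) w) (f w , proj₂ (Lp-≐ (f w) (tag f w)) (_ , x , refl) , refl)) ,
    (λ x → from-lift (proj₁ (proj₂ (proj₂ L) w) x))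
    where
    Lp-≐ : ∀ i → Lp i ≐ (λ z → Σ (Fin (n i)) λ j → Mp i j (tag (g i) z) × block (g i) j z)
    Lp-≐ i = proj₂ (proj₂ (proj₂ (proj₁ (proj₂ L) i)))

    from-lift : (Σ (Fin m) λ i → Lp i (tag f w) × block f i w) →
      Mp (f w) (g (f w) (tag f w)) (tag (g (f w)) (tag f w))
    from-lift (_ , y , refl) with proj₁ (Lp-≐ (f w) (tag f w)) y
    ... | _ , z , refl = z

  uniform-suffixal : ∃ λ h → ∀ i → Suffixal h (g i)
  uniform-suffixal = uniform _+_ {P = λ i h → Suffixal h (g i)}
    (λ i {m′} → (λ gs w u r → gs w u (proj₁ (longSuffix-refine {m = m′} r))) ,
                (λ gs w u r → gs w u (proj₂ (longSuffix-refine {m = m′} r))))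
    (λ i → suffixal (Q i))

  h : ℕ
  h = proj₁ uniform-suffixal

  g-suffixal : ∀ i → Suffixal h (g i)
  g-suffixal = proj₂ uniform-suffixal

  -- Residues are below `s`, so the last `H` letters contain the window of every word.
  H : ℕ
  H = window h s

  -- The phase `r` fixes where the window starts. Inside the word it comes from the tag of the
  -- current letter, at the end from the last letter.
  look : ℕ → Word (s * k) → Word k
  look r e = suf (window h r) (untag s e)

  look-tagged : ∀ {r} w → r ≡ length w % s → look r (suf H (tagged w)) ≡ recent h w
  look-tagged w refl = trans
    (cong (suf (window h (length w % s))) (trans (map-suf _ H (tagged w))
      (cong (suf H) (untag-tagAux s [] w))))
    (suf-suf (+-monoʳ-≤ (suc h * s) (<⇒≤ (m%n<n (length w) s))) w)

  ending : Word (s * k) → Word k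
  ending e = look (phase s e) e

  ending-tagged : ∀ w → ending (suf H (tagged w)) ≡ recent h w
  ending-tagged w = look-tagged w
    (trans (phase-suf s H {{H≢0}} (tagged w)) (phase-tagged s w))
    where
    H≢0 : NonZero H
    H≢0 = >-nonZero (≤-trans (>-nonZero⁻¹ s) (m≤n+m s (suc h * s)))

  -- A letter that completes a block yields the pumped block, tagged twice; other letters are
  -- erased. The inner tagging starts afresh because `f` does not see the base, whereas `g i` takes
  -- the base of the window as its context.
  output : ∀ i → Word (s * k) → Fin (s * k) → Word (n i * (m * k))
  output i q c =
    let r , a = remQuot {s} k c
        u     = look (toℕ r) q
    in tagAux (g i) (tag f (base u)) (tag f (emit (pending u) a))

  output-tagged : ∀ i p a → output i (suf H (tagged p)) (combine (residue p) a) ≡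
    tagAux (g i) (tag f (base p)) (tag f (emit (pending p) a))
  output-tagged i p a = trans
    (cong (λ x → let u = look (toℕ (proj₁ x)) (suf H (tagged p)) in
                 tagAux (g i) (tag f (base u)) (tag f (emit (pending u) (proj₂ x))))
          (remQuot-combine {s} (residue p) a))
    (trans
      (cong (λ u → tagAux (g i) (tag f (base u)) (tag f (emit (pending u) a)))
            (look-tagged p (toℕ-mod (length p))))
      (trans
        (cong (λ t → tagAux (g i) (tag f (base (recent h p))) (tag f (emit t a)))
              (sym (Recent.pending-≡ (recent-split h p))))
        (sym (tagAux-cong (g i) (recent-suffixal per (g-suffixal i) p) _))))

  -- The outputs add up to the base only; the pending letters are supplied by `target`.
  transduce-tagged : ∀ i w →
    transduce (output i ∘ suf H) [] (tagged w) ≡ tag (g i) (tag f (base w))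
  transduce-tagged i = go []
    where
    go : ∀ p w → tag (g i) (tag f (base p)) ++
      transduce (output i ∘ suf H) (tagged p) (tagAux residue p w) ≡
      tag (g i) (tag f (base (p ++ w)))
    go p []      = trans (++-identityʳ _) (cong (tag (g i) ∘ tag f ∘ base) (sym (++-identityʳ p)))
    go p (a ∷ w) = begin
      tag (g i) Y ++ (output i (suf H (tagged p)) c ++
        transduce (output i ∘ suf H) (tagged p ++ [ c ]) rest)
        ≡⟨ cong₂ (λ x q → tag (g i) Y ++ (x ++ transduce (output i ∘ suf H) q rest))
             (output-tagged i p a) (sym (tagAux-++ residue [] p [ a ])) ⟩
      tag (g i) Y ++ (tagAux (g i) Y (tag f (emit (pending p) a)) ++
        transduce (output i ∘ suf H) (tagged (p ++ [ a ])) rest)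
        ≡⟨ ++-assoc (tag (g i) Y) _ _ ⟨
      (tag (g i) Y ++ tagAux (g i) Y (tag f (emit (pending p) a))) ++
        transduce (output i ∘ suf H) (tagged (p ++ [ a ])) rest
        ≡⟨ cong (_++ transduce (output i ∘ suf H) (tagged (p ++ [ a ])) rest) (trans
             (sym (tagAux-++ (g i) [] Y _)) (cong (tag (g i)) (trans
               (sym (tag-base-++ per p (emit (pending p) a))) (cong (tag f) (sym (base-∷ʳ p a)))))) ⟩
      tag (g i) (tag f (base (p ++ [ a ]))) ++
        transduce (output i ∘ suf H) (tagged (p ++ [ a ])) rest
        ≡⟨ go (p ++ [ a ]) w ⟩
      tag (g i) (tag f (base ((p ++ [ a ]) ++ w)))
        ≡⟨ cong (tag (g i) ∘ tag f ∘ base) (++-assoc p [ a ] w) ⟩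
      tag (g i) (tag f (base (p ++ a ∷ w))) ∎
      where
      open ≡-Reasoning
      Y    = tag f (base p)
      c    = combine (residue p) a
      rest = tagAux residue (p ++ [ a ]) w

  -- Pending letters have produced no output, so a right quotient appends their tagged form. The
  -- window determines both block indices: `f` does not see the base, and `g i` is suffixal.
  target : ∀ u → Lang (n (f (pending u)) * (m * k))
  target u =
    let i = f (pending u) ; y = tag f (base u) ; z = tag f (pending u)
    in rightQuot (tagAux (g i) y z) (Mp i (g i (y ++ z)))

  realisation : Lang (s * k)
  realisation x = target u (transduce (output (f (pending u)) ∘ suf H) [] x)
    where u = ending (suf H x)

  realisation-∘SU : (C ∘ᶜ SU) (s * k) realisation
  -- The alphabet varies with the block of the pumped word, which the last `H` letters determine.
  realisation-∘SU = transduce-∘SU H (λ e → n (f (pending (ending e))) * (m * k))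
    (λ e → output (f (pending (ending e)))) (λ e → target (ending e))
    (λ e → closed-rightQuot _ (Mp∈C _ _))

  -- An equality of types, hence usable for rewriting. The chain exchanges the window for the whole
  -- word: first in the context of `g`, then in the pending letters, and finally under `f`, where
  -- the base is restored.
  realisation-tagged : ∀ w → let i = f (pumped w) ; z = tag f (pumped w) in
    realisation (tagged w) ≡ Mp i (g i z) (tag (g i) z)
  realisation-tagged w = begin
    realisation (tagged w)
      ≡⟨ cong (λ u → target u (transduce (output (f (pending u)) ∘ suf H) [] (tagged w)))
              (ending-tagged w) ⟩
    target u (transduce (output (f t) ∘ suf H) [] (tagged w))
      ≡⟨ cong (target u) (transduce-tagged (f t) w) ⟩
    Mp (f t) (g (f t) (tag f (base u) ++ tag f t))
      (tag (g (f t)) Y ++ tagAux (g (f t)) (tag f (base u)) (tag f t))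
      ≡⟨ cong₂ (λ j x → Mp (f t) j (tag (g (f t)) Y ++ x))
           (recent-suffixal per (g-suffixal (f t)) w (tag f t))
           (tagAux-cong (g (f t)) (recent-suffixal per (g-suffixal (f t)) w) (tag f t)) ⟨
    Mp (f t) (g (f t) (Y ++ tag f t)) (tag (g (f t)) Y ++ tagAux (g (f t)) Y (tag f t))
      ≡⟨ cong (λ x → Mp (f t) (g (f t) (Y ++ tag f t)) x) (tagAux-++ (g (f t)) [] Y (tag f t)) ⟨
    value (f t) (Y ++ tag f t)
      ≡⟨ cong (λ t → value (f t) (Y ++ tag f t)) (Recent.pending-≡ (recent-split h w)) ⟨
    value (f (pending w)) (Y ++ tag f (pending w))
      ≡⟨ cong₂ value (base-periodic per w (pending w)) (tag-base-++ per w (pending w)) ⟨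
    value (f (pumped w)) (tag f (pumped w)) ∎
    where
    open ≡-Reasoning
    u = recent h w
    t = pending u
    Y = tag f (base w)
    value : Fin m → Word (m * k) → Set
    value i z = Mp i (g i z) (tag (g i) z)

  realisation-correct : ∀ w →
    (realisation (tagged w) → K (pumped w)) × (K (pumped w) → realisation (tagged w))
  realisation-correct w rewrite realisation-tagged w = K-via-Mp (pumped w)

-- The automaton of the tagged words

module _ {k : ℕ} (s : ℕ) .{{_ : NonZero s}} (A : DFA k) where
  open Residue {k} s

  private
    state : Fin s → Fin (states A) → Fin (suc (s * states A))
    state r q = suc (combine r q)

    advanceIf : ∀ {r r′} → Fin (states A) → Dec (r ≡ r′) → Fin (suc (s * states A))
    advanceIf {r} q (yes _) = state (next r) q
    advanceIf     q (no _)  = zero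

    advance : Fin s × Fin (states A) → Fin s × Fin k → Fin (suc (s * states A))
    advance (r , q) (r′ , a) = advanceIf (δ A q a) (r Fin.≟ r′)

  -- Simulates `A` while counting letters modulo `s`. A letter whose tag disagrees with the count
  -- leads to the rejecting sink `zero`, so only correctly tagged words are accepted.
  tagDFA : DFA (s * k)
  tagDFA = record
    { states = suc (s * states A)
    ; init   = state (residue []) (init A)
    ; δ      = λ { zero    c → zero
                 ; (suc x) c → advance (remQuot {s} (states A) x) (remQuot {s} k c) }
    ; accept = λ { zero    → false
                 ; (suc x) → accept A (proj₂ (remQuot {s} (states A) x)) }
    }

  private
    δ-state : ∀ r q c → δ tagDFA (state r q) c ≡ advance (r , q) (remQuot {s} k c)
    δ-state r q c = cong (λ x → advance x (remQuot {s} k c)) (remQuot-combine {s} r q)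

    run-sink : ∀ x → run tagDFA zero x ≡ zero
    run-sink []      = refl
    run-sink (c ∷ x) = run-sink x

    run-tagAux : ∀ p q w → run tagDFA (state (residue p) q) (tagAux residue p w) ≡
      state (residue (p ++ w)) (run A q w)
    run-tagAux p q []      = cong (λ u → state (residue u) q) (sym (++-identityʳ p))
    run-tagAux p q (a ∷ w) = trans
      (cong (λ x → run tagDFA x (tagAux residue (p ++ [ a ]) w)) (trans
        (δ-state (residue p) q (combine (residue p) a))
        (trans (cong (advance (residue p , q)) (remQuot-combine {s} (residue p) a))
          (trans (match (residue p Fin.≟ residue p))
            (cong (λ r → state r (δ A q a)) (sym (residue-∷ʳ p a)))))))
      (trans (run-tagAux (p ++ [ a ]) (δ A q a) w)
        (cong (λ u → state (residue u) (run A (δ A q a) w)) (++-assoc p [ a ] w)))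
      where
      match : ∀ {r q} (e : Dec (r ≡ r)) → advanceIf {r} {r} q e ≡ state (next r) q
      match (yes _)  = refl
      match (no neq) = contradiction refl neq

    run-tagged : ∀ w → accept tagDFA (run tagDFA (init tagDFA) (tagged w)) ≡
      accept A (run A (init A) w)
    run-tagged w = trans (cong (accept tagDFA) (run-tagAux [] (init A) w))
      (cong (accept A ∘ proj₂) (remQuot-combine {s} (residue w) _))

    accepted-tagAux : ∀ p q x → T (accept tagDFA (run tagDFA (state (residue p) q) x)) →
      ∃ λ w → tagAux residue p w ≡ x
    accepted-tagAux p q []      acc = [] , refl
    accepted-tagAux p q (c ∷ x) acc =
      onAdvance (residue p Fin.≟ r)
        (subst (λ y → T (accept tagDFA (run tagDFA y x))) (δ-state (residue p) q c) acc)
      where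
      r = proj₁ (remQuot {s} k c)
      a = proj₂ (remQuot {s} k c)
      onAdvance : ∀ e → T (accept tagDFA (run tagDFA (advanceIf {residue p} {r} (δ A q a) e) x)) →
        ∃ λ w → tagAux residue p w ≡ c ∷ x
      onAdvance (yes eq) acc =
        let w , eq′ = accepted-tagAux (p ++ [ a ]) (δ A q a) x
              (subst (λ r → T (accept tagDFA (run tagDFA (state r (δ A q a)) x)))
                     (sym (residue-∷ʳ p a)) acc)
        in a ∷ w , cong₂ _∷_ (trans (cong (λ r → combine r a) eq) (combine-remQuot {s} k c)) eq′
      onAdvance (no _) acc = ⊥-elim (subst (T ∘ accept tagDFA) (run-sink x) acc)

  lang-tagged : ∀ w → lang A w → lang tagDFA (tagged w)
  lang-tagged w = subst T (sym (run-tagged w))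

  lang-tagDFA : ∀ x → lang tagDFA x → ∃ λ w → tagged w ≡ x × lang A w
  lang-tagDFA x acc with accepted-tagAux [] (init A) x acc
  ... | w , refl = w , refl , subst T (run-tagged w) acc

-- A uniform pumping lemma

SameRuns : ∀ {k} → List (DFA k) → Word k → Word k → Set
SameRuns As u v = All (λ A → SameRun A u v) As

-- The class of a word codes its transition maps in all the automata at once; an automaton
-- contributes `states A ^ states A` possible maps.
classify : ∀ {k} (As : List (DFA k)) → ∃ λ N → Σ (Word k → Fin N) λ c →
  ∀ u v → c u ≡ c v → SameRuns As u v
classify [] = 1 , (λ _ → zero) , λ _ _ _ → []
classify (A ∷ As) with classify As
... | N , c , sound = states A ^ states A * N ,
  (λ u → combine (runs u) (c u)) ,
  λ u v eq → (λ q → trans (sym (finToFun-funToFin (λ q → run A q u) q)) (trans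
      (cong (λ i → finToFun i q) (combine-injectiveˡ (runs u) (c u) (runs v) (c v) eq))
      (finToFun-funToFin (λ q → run A q v) q)))
    ∷ sound u v (combine-injectiveʳ (runs u) (c u) (runs v) (c v) eq)
  where
  runs : Word _ → Fin (states A ^ states A)
  runs u = funToFin (λ q → run A q u)

power : ∀ {A : Set} → ℕ → List A → List A
power zero    y = []
power (suc n) y = y ++ power n y

length-power : ∀ {A : Set} n (y : List A) → length (power n y) ≡ n * length y
length-power zero    y = refl
length-power (suc n) y = trans (length-++ y) (cong (length y +_) (length-power n y))

sameRun-power : ∀ {k} (A : DFA k) x y → SameRun A x (x ++ y) →
  ∀ n → SameRun A x (x ++ power n y)
sameRun-power A x y loop zero    q = cong (run A q) (sym (++-identityʳ x))
sameRun-power A x y loop (suc n) q = trans (sameRun-power A x y loop n q)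
  (trans (sameRun-++ A {x} {x ++ y} {power n y} loop (λ _ → refl) q)
         (cong (run A q) (++-assoc x y (power n y))))

∣-! : ∀ {p n} → 1 ≤ p → p ≤ n → p ∣ n !
∣-! {suc p} _ p≤n = ∣-trans (m∣m*n (p !)) (m≤n⇒m!∣n! p≤n)

n≤n! : ∀ n → n ≤ n !
n≤n! zero    = z≤n
n≤n! (suc n) = ≤-trans (≤-reflexive (sym (*-identityʳ (suc n)))) (*-monoʳ-≤ (suc n) (1≤n! n))

-- Pigeonhole on the `suc N` prefixes of length at most `N`: two share a class, and `y` is what the
-- longer one adds to the shorter.
loop-factor : ∀ {k N} (c : Word k → Fin N) (b : Word k) → N ≤ length b →
  ∃ λ x → ∃ λ y → ∃ λ z → b ≡ (x ++ y) ++ z × c x ≡ c (x ++ y) × 1 ≤ length y × length y ≤ N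
loop-factor {N = N} c b N≤b with pigeonhole (n<1+n N) (λ i → c (take (toℕ i) b))
... | i , j , i<j , eq = take (toℕ i) b , drop (toℕ i) t , drop (toℕ j) b ,
  trans (sym (take++drop≡id (toℕ j) b)) (cong (_++ drop (toℕ j) b) (sym xy)) ,
  trans eq (cong c (sym xy)) ,
  subst (1 ≤_) (sym len) (m<n⇒0<n∸m i<j) ,
  ≤-trans (≤-reflexive len) (≤-trans (m∸n≤m (toℕ j) (toℕ i)) j≤N)
  where
  t = take (toℕ j) b
  j≤N : toℕ j ≤ N
  j≤N = s≤s⁻¹ (toℕ<n j)
  xy : take (toℕ i) b ++ drop (toℕ i) t ≡ t
  xy = trans (cong (_++ drop (toℕ i) t)
    (sym (trans (take-take (toℕ i) (toℕ j) b) (cong (λ l → take l b) (m≤n⇒m⊓n≡m (<⇒≤ i<j))))))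
    (take++drop≡id (toℕ i) t)
  len : length (drop (toℕ i) t) ≡ toℕ j ∸ toℕ i
  len = trans (length-drop (toℕ i) t) (cong (_∸ toℕ i)
    (trans (length-take (toℕ j) b) (m≤n⇒m⊓n≡m (≤-trans j≤N N≤b))))

-- `period` is fixed before `n`: the reduction may depend only on the automata, while the modulus
-- `suc n` comes from an unknown cover or separator.
record Pumping {k : ℕ} (As : List (DFA k)) : Set where
  field
    period  : ℕ
    period≢0 : NonZero period
    words   : ∀ (r : Fin period) → ∃ λ (w : Word k) → length w ≡ toℕ r
    pump    : ∀ n b → length b ≡ period → ∃ λ b′ → length b′ ≡ period * suc n × SameRuns As b b′

pumping : ∀ k (As : List (DFA k)) → Pumping As
-- Over the empty alphabet only length 0 occurs, which forces period 1; there is then no block to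
-- pump.
pumping zero As = record
  { period  = 1
  ; period≢0 = _
  ; words   = λ { zero → [] , refl }
  ; pump    = λ { _ (() ∷ _) _ }
  }
pumping (suc k) As with classify As
... | N , c , sound = record
  { period  = N !
  ; period≢0 = N !≢0
  ; words   = λ r → replicate (toℕ r) zero , length-replicate (toℕ r)
  ; pump    = λ n b len →
      pump n b len (loop-factor c b (≤-trans (n≤n! N) (≤-reflexive (sym len))))
  }
  where
  pump : ∀ n b → length b ≡ N ! →
    (∃ λ x → ∃ λ y → ∃ λ z → b ≡ (x ++ y) ++ z × c x ≡ c (x ++ y) × 1 ≤ length y × length y ≤ N) →
    ∃ λ b′ → length b′ ≡ N ! * suc n × SameRuns As b b′
  pump n b len (x , y , z , refl , eq , 1≤y , y≤N) with ∣-! 1≤y y≤N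
  -- As `N !` is `r * length y`, the `n * r` additional copies of `y` add exactly `n * N !` letters.
  ... | divides r N!≡ = (x ++ power (suc (n * r)) y) ++ z , length-pumped ,
    All.map (λ {A} loop → sameRun-++ A {x ++ y} {x ++ power (suc (n * r)) y} {z}
        (λ q → trans (sym (loop q)) (sameRun-power A x y loop (suc (n * r)) q)) (λ _ → refl))
      (sound x (x ++ y) eq)
    where
    open ≡-Reasoning
    length-pumped : length ((x ++ power (suc (n * r)) y) ++ z) ≡ N ! * suc n
    length-pumped = begin
      length ((x ++ (y ++ power (n * r) y)) ++ z)
        ≡⟨ cong (λ u → length (u ++ z)) (++-assoc x y (power (n * r) y)) ⟨
      length (((x ++ y) ++ power (n * r) y) ++ z)
        ≡⟨ trans (length-++ ((x ++ y) ++ power (n * r) y)) (cong (_+ length z) (length-++ (x ++ y))) ⟩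
      length (x ++ y) + length (power (n * r) y) + length z
        ≡⟨ +-assoc (length (x ++ y)) _ _ ⟩
      length (x ++ y) + (length (power (n * r) y) + length z)
        ≡⟨ cong (length (x ++ y) +_) (+-comm (length (power (n * r) y)) (length z)) ⟩
      length (x ++ y) + (length z + length (power (n * r) y))
        ≡⟨ +-assoc (length (x ++ y)) _ _ ⟨
      length (x ++ y) + length z + length (power (n * r) y)
        ≡⟨ cong₂ _+_ (trans (sym (length-++ (x ++ y))) len) (trans (length-power (n * r) y)
             (trans (*-assoc n r (length y)) (cong (n *_) (sym N!≡)))) ⟩
      N ! + n * N !
        ≡⟨ *-comm (suc n) (N !) ⟩
      N ! * suc n ∎

-- Transporting covers and separators

module _ {k k′ : ℕ} {I : Set} (ψ : I → Word k) (ψ′ : I → Word k′) where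

  Pulls : Lang k → Lang k′ → Set
  Pulls L L′ = ∀ x → L′ x → ∃ λ i → ψ′ i ≡ x × L (ψ i)

module _ (Y : Class) {k k′ : ℕ} {I : Set} (ψ : I → Word k) (ψ′ : I → Word k′) where

  -- `K′` is constrained on the image of `ψ′` only; this suffices because `Pulls` places `L′` inside
  -- that image. The reduction uses `inflate n` with `tagged` in one direction, and `tagged` with
  -- `id` in the other.
  Transfer : Lang k → Set₁
  Transfer K = Σ (Lang k′) λ K′ → Y k′ K′ × (∀ i → (K′ (ψ′ i) → K (ψ i)) × (K (ψ i) → K′ (ψ′ i)))

  transfer-disjoint : ∀ {K L L′} (t : Transfer K) → Pulls ψ ψ′ L L′ →
    Disjoint K L → Disjoint (proj₁ t) L′
  transfer-disjoint (_ , _ , iff) pulls dis x x∈K′ x∈L′ with pulls x x∈L′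
  ... | i , refl , l = dis (ψ i) (proj₁ (iff i) x∈K′) l

  transfer-contains : ∀ {K L L′} (t : Transfer K) → Pulls ψ ψ′ L L′ →
    (∀ w → L w → K w) → ∀ x → L′ x → proj₁ t x
  transfer-contains (_ , _ , iff) pulls sub x x∈L′ with pulls x x∈L′
  ... | i , refl , l = proj₂ (iff i) (sub (ψ i) l)

  separable-transfer : ∀ (X : Class) {L₁ L₂ L₁′ L₂′} → Pulls ψ ψ′ L₁ L₁′ → Pulls ψ ψ′ L₂ L₂′ →
    (sep : Separable X k L₁ L₂) → Transfer (proj₁ sep) → Separable Y k′ L₁′ L₂′
  separable-transfer _ p₁ p₂ (_ , _ , sub , dis) t =
    proj₁ t , proj₁ (proj₂ t) , transfer-contains t p₁ sub , transfer-disjoint t p₂ dis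

  module _ {A : Set} (l : A → Lang k) (l′ : A → Lang k′) where

    disjoint-any : ∀ {K as} (t : Transfer K) → All (λ a → Pulls ψ ψ′ (l a) (l′ a)) as →
      Any (λ a → Disjoint K (l a)) as → Any (λ a → Disjoint (proj₁ t) (l′ a)) as
    disjoint-any t (p ∷ _)  (here dis)  = here (transfer-disjoint t p dis)
    disjoint-any t (_ ∷ ps) (there dis) = there (disjoint-any t ps dis)

    transfer-list : ∀ {as Ks} → All (λ a → Pulls ψ ψ′ (l a) (l′ a)) as → All Transfer Ks →
      All (λ K → Any (Disjoint K) (map l as)) Ks →
      Σ (List (Lang k′)) λ Ks′ → All (Y k′) Ks′ ×
        (∀ i → Any (λ K → K (ψ i)) Ks → Any (λ K′ → K′ (ψ′ i)) Ks′) ×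
        All (λ K′ → Any (Disjoint K′) (map l′ as)) Ks′
    transfer-list ps [] [] = [] , [] , (λ _ ()) , []
    transfer-list ps (t ∷ ts) (dis ∷ diss) with transfer-list ps ts diss
    ... | Ks′ , Ks′∈Y , cov , diss′ = proj₁ t ∷ Ks′ , proj₁ (proj₂ t) ∷ Ks′∈Y ,
      (λ { i (here x)  → here (proj₂ (proj₂ (proj₂ t) i) x)
         ; i (there x) → there (cov i x) }) ,
      Any.map⁺ (disjoint-any t ps (Any.map⁻ dis)) ∷ diss′

    coverable-transfer : ∀ (X : Class) {L₁ L₁′ as} → Pulls ψ ψ′ L₁ L₁′ → All (λ a → Pulls ψ ψ′ (l a) (l′ a)) as →
      (cov : Coverable X k L₁ (map l as)) → All Transfer (proj₁ cov) →
      Coverable Y k′ L₁′ (map l′ as)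
    coverable-transfer _ {L₁′ = L₁′} p ps (Ks , _ , cov , dis) ts with transfer-list ps ts dis
    ... | Ks′ , Ks′∈Y , cov′ , dis′ = Ks′ , Ks′∈Y , covers , dis′
      where
      covers : ∀ x → L₁′ x → Any (λ K′ → K′ x) Ks′
      covers x x∈L₁′ with p x x∈L₁′
      ... | i , refl , i∈L₁ = cov′ i (cov (ψ i) i∈L₁)

-- The reduction and its two directions

module Reduction {C : Class} (V : IsPositiveVariety C) {k : ℕ} {As : List (DFA k)}
  (P : Pumping As) where
  open Pumping P

  private instance
    period-nonZero : NonZero period
    period-nonZero = period≢0

  open Residue {k} period

  private
    D = C ∘ᶜ SU

    HasModulus : Lang k → ℕ → Set₁
    HasModulus K d = Σ (Partition MOD k) λ P →
      Periodic d (Partition.blockOf P) × Liftable D (Partition.blockOf P) K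

    hasModulus : ∀ {K} → (D ∘ᶜ MOD) k K → ∃ (HasModulus K)
    hasModulus (P , L) = let d , per = periodic P in d , P , per , L

    hasModulus-⊛ˡ : ∀ {K m n} → HasModulus K m → HasModulus K (m ⊛ n)
    hasModulus-⊛ˡ {m = m} {n} (P , per , L) =
      P , (λ u v r → per u v (proj₁ (modEquiv-refine {m = m} {n} {u} {v} r))) , L

    hasModulus-⊛ʳ : ∀ {K m n} → HasModulus K n → HasModulus K (m ⊛ n)
    hasModulus-⊛ʳ {m = m} {n} (P , per , L) =
      P , (λ u v r → per u v (proj₂ (modEquiv-refine {m = m} {n} {u} {v} r))) , L

    -- A cover has to be transferred along a single map `inflate n`, so its finitely many languages
    -- are brought to one modulus, a product.
    commonModulus : ∀ {Ks} → All ((D ∘ᶜ MOD) k) Ks → ∃ λ d → All (λ K → HasModulus K d) Ks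
    commonModulus []       = 0 , []
    commonModulus (x ∷ xs) with hasModulus x | commonModulus xs
    ... | m , y | n , ys = m ⊛ n , hasModulus-⊛ˡ {m = m} {n} y ∷ All.map (hasModulus-⊛ʳ {m = m}) ys

    -- Complete blocks always have length `period`; the identity on other words is a mere default.
    replacementIf : ∀ n b → Dec (length b ≡ period) → Word k
    replacementIf n b (yes eq) = proj₁ (pump n b eq)
    replacementIf n b (no _)   = b

    replacement : ℕ → Word k → Word k
    replacement n b = replacementIf n b (length b ≟ period)

    length-replacement : ∀ n b → length b ≡ period → length (replacement n b) ≡ period * suc n
    length-replacement n b len = onDec (length b ≟ period)
      where
      onDec : ∀ e → length (replacementIf n b e) ≡ period * suc n
      onDec (yes eq) = proj₁ (proj₂ (pump n b eq))
      onDec (no neq) = contradiction len neq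

    sameRuns-replacement : ∀ n b → length b ≡ period → SameRuns As b (replacement n b)
    sameRuns-replacement n b len = onDec (length b ≟ period)
      where
      onDec : ∀ e → SameRuns As b (replacementIf n b e)
      onDec (yes eq) = proj₂ (proj₂ (pump n b eq))
      onDec (no neq) = contradiction len neq

    inflate : ℕ → Word k → Word k
    inflate n = Blocks.pumped period (replacement n)

    inflate-transfer : ∀ {n K} → HasModulus K n → Transfer D (inflate n) tagged K
    inflate-transfer {n} (P , per , L) = realisation , realisation-∘SU , realisation-correct
      where open Realise V period (replacement n) n (length-replacement n) P per L

    tagged-transfer : ∀ {K} → D (period * k) K → Transfer (D ∘ᶜ MOD) tagged id K
    tagged-transfer {K} K∈D = K ∘ tagged , tagged-∘MOD D words K∈D , λ _ → id , id

  reduce : DFA k → DFA (period * k)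
  reduce = tagDFA period

  private
    -- A word accepted by `reduce A` is `tagged w` for some `w` in `lang A`, and inflating `w`
    -- preserves its run in every automaton of `As`.
    inflate-pulls : ∀ n → All (λ A → Pulls (inflate n) tagged (lang A) (lang (reduce A))) As
    inflate-pulls n = All.tabulate λ {A} A∈As x x∈A′ →
      let w , eq , w∈A = lang-tagDFA period A x x∈A′
      in w , eq , subst (T ∘ accept A)
           (Blocks.pumped-sameRun period (replacement n) A
             (λ b len → All.lookup (sameRuns-replacement n b len) A∈As) w (init A)) w∈A

    tagged-pulls : ∀ A → Pulls tagged id (lang (reduce A)) (lang A)
    tagged-pulls A w w∈A = w , refl , lang-tagged period A w w∈A

  covering-to : ∀ {A₁ A₂} → As ≡ A₁ ∷ A₂ →
    Coverable (D ∘ᶜ MOD) k (lang A₁) (map lang A₂) →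
    Coverable D (period * k) (lang (reduce A₁)) (map lang (map reduce A₂))
  -- The modulus is extracted from the given cover, after `reduce` has been fixed.
  covering-to {A₁} {A₂} refl cov with commonModulus (proj₁ (proj₂ cov))
  ... | n , mods with inflate-pulls n
  ...   | p ∷ ps = subst (Coverable D _ _) (map-∘ A₂)
    (coverable-transfer D (inflate n) tagged lang (lang ∘ reduce) (D ∘ᶜ MOD) p ps cov
      (All.map inflate-transfer mods))

  covering-from : ∀ {A₁ A₂} →
    Coverable D (period * k) (lang (reduce A₁)) (map lang (map reduce A₂)) →
    Coverable (D ∘ᶜ MOD) k (lang A₁) (map lang A₂)
  covering-from {A₁} {A₂} cov = coverable-transfer (D ∘ᶜ MOD) tagged id (lang ∘ reduce) lang D
    (tagged-pulls A₁) (All.tabulate λ {A} _ → tagged-pulls A) cov′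
    (All.map tagged-transfer (proj₁ (proj₂ cov′)))
    where
    cov′ : Coverable D (period * k) (lang (reduce A₁)) (map (lang ∘ reduce) A₂)
    cov′ = subst (Coverable D _ _) (sym (map-∘ A₂)) cov

  separation-to : ∀ {A₁ A₂} → As ≡ A₁ ∷ A₂ ∷ [] →
    Separable (D ∘ᶜ MOD) k (lang A₁) (lang A₂) →
    Separable D (period * k) (lang (reduce A₁)) (lang (reduce A₂))
  separation-to refl sep with hasModulus (proj₁ (proj₂ sep))
  ... | n , mod with inflate-pulls n
  ...   | p₁ ∷ p₂ ∷ [] = separable-transfer D (inflate n) tagged (D ∘ᶜ MOD) p₁ p₂ sep (inflate-transfer mod)

  separation-from : ∀ {A₁ A₂} →
    Separable D (period * k) (lang (reduce A₁)) (lang (reduce A₂)) →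
    Separable (D ∘ᶜ MOD) k (lang A₁) (lang A₂)
  separation-from {A₁} {A₂} sep = separable-transfer (D ∘ᶜ MOD) tagged id D
    (tagged-pulls A₁) (tagged-pulls A₂) sep (tagged-transfer (proj₁ (proj₂ sep)))

-- Transfer of decidability

theorem5p1 : (C : Class) → IsPositiveVariety C →
    (CoveringDecidable (C ∘ᶜ SU) → CoveringDecidable ((C ∘ᶜ SU) ∘ᶜ MOD)) ×
    (SeparationDecidable (C ∘ᶜ SU) → SeparationDecidable ((C ∘ᶜ SU) ∘ᶜ MOD))
theorem5p1 C V = covering , separation
  where
  covering : CoveringDecidable (C ∘ᶜ SU) → CoveringDecidable ((C ∘ᶜ SU) ∘ᶜ MOD)
  covering decide k A₁ A₂ =
    map′ covering-from (covering-to refl) (decide _ (reduce A₁) (map reduce A₂))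
    where open Reduction V (pumping k (A₁ ∷ A₂))

  separation : SeparationDecidable (C ∘ᶜ SU) → SeparationDecidable ((C ∘ᶜ SU) ∘ᶜ MOD)
  separation decide k A₁ A₂ =
    map′ separation-from (separation-to refl) (decide _ (reduce A₁) (reduce A₂))
    where open Reduction V (pumping k (A₁ ∷ A₂ ∷ []))
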